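{- For every fixed integer $k\ge 2$, $\chi_1(KG(n,k))=n-\Theta(n^{1/k})$ as $n\to\infty$; that is, there exist constants $c_1,c_2>0$ and $N$ depending only on $k$ such that $c_1 n^{1/k}\le n-\chi_1(KG(n,k))\le c_2 n^{1/k}$ for all $n\ge N$.
   Context: For integers $k\ge 2$, $n\ge 2k$, the Kneser graph $KG(n,k)$ has vertex set $\binom{[n]}{k}$, two $k$-subsets of $[n]$ being adjacent iff they are disjoint. A 1-selection of a graph $G=(V,E)$ is a map $f$ assigning to each vertex $v$ a set $f(v)$ of at most one edge incident with $v$; the 1-removed subgraph $G_f$ has vertex set $V$ and edge set $E\setminus\bigcup_v f(v)$. The robust chromatic number is $\chi_1(G)=\min_f\chi(G_f)$ over all 1-selections $f$. -}

module Defs where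

open import Data.Nat using (ℕ; _<_)
open import Data.Fin using (Fin)
open import Data.Fin.Subset using (Subset; ∣_∣; _∩_; Empty)
open import Data.Maybe using (Maybe; just)
open import Data.Product using (Σ; ∃; _×_; proj₁)
open import Relation.Binary.PropositionalEquality using (_≡_; _≢_)
open import Relation.Nullary using (¬_)

record Graph : Set₁ where
  field
    V   : Set
    Adj : V → V → Set

open Graph public

-- A 1-selection: each vertex v selects at most one incident edge {v,w},
-- encoded as  f v = nothing  (no edge) or  f v = just w  with w adjacent to v.
OneSelection : Graph → Set
OneSelection G = Σ (V G → Maybe (V G)) λ f → ∀ v w → f v ≡ just w → Adj G v w

-- Proper m-colouring of the 1-removed subgraph G_f: the edge {u,w} survives
-- iff it was selected neither by u nor by w.
ProperColouringOfRemoved : (G : Graph) → OneSelection G → (m : ℕ) → (V G → Fin m) → Set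
ProperColouringOfRemoved G f m c =
  ∀ u w → Adj G u w → ¬ (proj₁ f u ≡ just w) → ¬ (proj₁ f w ≡ just u) → c u ≢ c w

Robust1Colourable : Graph → ℕ → Set
Robust1Colourable G m = ∃ λ (f : OneSelection G) → ∃ λ (c : V G → Fin m) → ProperColouringOfRemoved G f m c

IsRobustChromaticNumber : Graph → ℕ → Set
IsRobustChromaticNumber G m = Robust1Colourable G m × (∀ m′ → m′ < m → ¬ Robust1Colourable G m′)

KG : ℕ → ℕ → Graph
KG n k = record
  { V   = Σ (Subset n) (λ s → ∣ s ∣ ≡ k)
  ; Adj = λ s t → Empty (proj₁ s ∩ proj₁ t)
  }

{-# OPTIONS --safe #-}
module Submission where

-- Few colours suffice: let T be a set of t points with t^k + t ≤ n. A k-set not inside T is coloured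
-- by one of its points outside T. The at most t^k ≤ n − t many k-sets inside T get distinct colours
-- x ∉ T, and every member of the star at x selects its edge to the k-set coloured x.
--
-- Many colours are needed: if A ≠ B have the same colour, then every other set of that colour except
-- f(A) and f(B) meets A ∪ B, since it can select only one of A, B. Hence, within a ground set Y of
-- y points, a colour class having more than O(y^(k-2)) sets through a point x has at most one set
-- avoiding x. Delete such points x together with their colours, one at a time; each deletion leaves
-- one exceptional set, and y minus the number of colours does not decrease. At the end every class
-- has O(y^(k-2)) sets, so C(y,k) ≤ n + O(y^(k-1)), that is y = O(n^(1/k)), while y ≥ n − χ.

open import Defs
import Data.Bool.Properties as Bool
open import Data.Empty using () renaming (⊥ to ⊥₀)
open import Data.Fin using (Fin; zero; suc; toℕ; inject≤; _↑ˡ_)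
import Data.Fin.Properties as Fin
open import Data.Fin.Subset using (Subset; ∣_∣; _∩_; _∪_; _-_; Empty; ⁅_⁆; ⊥; ⊤; inside; outside; _⊆_)
  renaming (_∈_ to _∈ˢ_; _∉_ to _∉ˢ_)
open import Data.Fin.Subset.Properties
open import Data.List using (List; []; _∷_; [_]; _++_; length; map; concatMap; filter; upTo; lookup)
open import Data.List.Membership.Propositional using (_∈_; find; lose)
open import Data.List.Membership.Propositional.Properties
open import Data.List.Properties using (length-map; length-++; filter-notAll; length-upTo)
open import Data.List.Relation.Unary.All as All using ()
open import Data.List.Relation.Unary.AllPairs using ([]; _∷_)
open import Data.List.Relation.Unary.Any as Any using (here; there; any?; index)
open import Data.List.Relation.Unary.Any.Properties using (lookup-index)
open import Data.List.Relation.Unary.Unique.Propositional using (Unique)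
import Data.List.Relation.Unary.Unique.Propositional.Properties as Unique
open import Data.Maybe using (Maybe; just; nothing; maybe′)
open import Data.Nat hiding (∣_-_∣)
open import Data.Nat.Combinatorics using (_C_; nCk+nC[k+1]≡[n+1]C[k+1])
open import Data.Nat.DivMod using (_/_; _%_; m≡m%n+[m/n]*n; m/n*n≤m; m%n<n)
open import Data.Nat.Properties
open import Data.Nat.Tactic.RingSolver using (solve-∀)
open import Data.Product using (∃; ∃₂; _×_; _,_; proj₁; proj₂)
open import Data.Sum using (_⊎_; inj₁; inj₂; [_,_]′)
open import Data.Vec using ([]; _∷_; here; there)
open import Data.Vec.Properties using (∷-injectiveʳ; ≡-dec)
open import Function using (_∘_; id)
open import Relation.Binary.PropositionalEquality hiding ([_])
open import Relation.Nullary using (¬_; contradiction; yes; no; ¬?; Dec; _×-dec_)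

-- Counting with duplicate-free lists.

-- Pigeonhole: remove one occurrence of the head of `xs` from `ys`; by uniqueness the rest of `xs`
-- still lies in what remains.
unique-⊆⇒length≤ : ∀ {A : Set} {xs ys : List A} → Unique xs → (∀ {x} → x ∈ xs → x ∈ ys) →
                   length xs ≤ length ys
unique-⊆⇒length≤ [] sub = z≤n
unique-⊆⇒length≤ {xs = x ∷ xs} (x≢xs ∷ u) sub with ∈-∃++ (sub (here refl))
... | ys , zs , refl = begin
  suc (length xs)              ≤⟨ s≤s (unique-⊆⇒length≤ u sub′) ⟩
  suc (length (ys ++ zs))      ≡⟨ cong suc (length-++ ys) ⟩
  suc (length ys + length zs)  ≡⟨ +-suc (length ys) (length zs) ⟨
  length ys + suc (length zs)  ≡⟨ length-++ ys ⟨
  length (ys ++ x ∷ zs)        ∎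
  where
  open ≤-Reasoning
  sub′ : ∀ {y} → y ∈ xs → y ∈ ys ++ zs
  sub′ y∈xs with ∈-++⁻ ys (sub (there y∈xs))
  ... | inj₁ y∈ys          = ∈-++⁺ˡ y∈ys
  ... | inj₂ (here refl)   = contradiction refl (All.lookup x≢xs y∈xs)
  ... | inj₂ (there y∈zs)  = ∈-++⁺ʳ ys y∈zs

unique⇒length≤1⊎distinct : ∀ {A : Set} {xs : List A} → Unique xs →
                           length xs ≤ 1 ⊎ ∃₂ λ x y → x ∈ xs × y ∈ xs × x ≢ y
unique⇒length≤1⊎distinct {xs = []}         _            = inj₁ z≤n
unique⇒length≤1⊎distinct {xs = _ ∷ []}     _            = inj₁ (s≤s z≤n)
unique⇒length≤1⊎distinct {xs = x ∷ y ∷ xs} (x≢ ∷ _) =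
  inj₂ (x , y , here refl , there (here refl) , All.lookup x≢ (here refl))

length-concatMap≤ : ∀ {A B : Set} (f : A → List B) b (xs : List A) →
                    (∀ {x} → x ∈ xs → length (f x) ≤ b) → length (concatMap f xs) ≤ length xs * b
length-concatMap≤ f b []       bound = z≤n
length-concatMap≤ f b (x ∷ xs) bound = begin
  length (f x ++ concatMap f xs)          ≡⟨ length-++ (f x) ⟩
  length (f x) + length (concatMap f xs)  ≤⟨ +-mono-≤ (bound (here refl)) (length-concatMap≤ f b xs (bound ∘ there)) ⟩
  b + length xs * b                       ∎
  where open ≤-Reasoning

-- Elements and sizes of finite subsets.

elements : ∀ {n} → Subset n → List (Fin n)
elements []            = []
elements (inside  ∷ p) = zero ∷ map suc (elements p)
elements (outside ∷ p) = map suc (elements p)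

∈-elements⁺ : ∀ {n} {x : Fin n} (p : Subset n) → x ∈ˢ p → x ∈ elements p
∈-elements⁺ (inside  ∷ p) here       = here refl
∈-elements⁺ (inside  ∷ p) (there x∈) = there (∈-map⁺ suc (∈-elements⁺ p x∈))
∈-elements⁺ (outside ∷ p) (there x∈) = ∈-map⁺ suc (∈-elements⁺ p x∈)

∈-elements⁻ : ∀ {n} {x : Fin n} (p : Subset n) → x ∈ elements p → x ∈ˢ p
∈-elements⁻ (inside ∷ p) (here refl) = here
∈-elements⁻ (inside ∷ p) (there x∈) with ∈-map⁻ suc x∈
... | _ , y∈ , refl = there (∈-elements⁻ p y∈)
∈-elements⁻ (outside ∷ p) x∈ with ∈-map⁻ suc x∈
... | _ , y∈ , refl = there (∈-elements⁻ p y∈)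

length-elements : ∀ {n} (p : Subset n) → length (elements p) ≡ ∣ p ∣
length-elements []            = refl
length-elements (inside  ∷ p) = cong suc (trans (length-map suc (elements p)) (length-elements p))
length-elements (outside ∷ p) = trans (length-map suc (elements p)) (length-elements p)

∣p∣≤1+∣p-x∣ : ∀ {n} (p : Subset n) x → ∣ p ∣ ≤ suc ∣ p - x ∣
∣p∣≤1+∣p-x∣ (inside  ∷ p) zero = s≤s (≤-reflexive (cong ∣_∣ (sym (p─⊥≡p p))))
∣p∣≤1+∣p-x∣ (outside ∷ p) zero = m≤n⇒m≤1+n (≤-reflexive (cong ∣_∣ (sym (p─⊥≡p p))))
∣p∣≤1+∣p-x∣ (inside  ∷ p) (suc x) = s≤s (∣p∣≤1+∣p-x∣ p x)
∣p∣≤1+∣p-x∣ (outside ∷ p) (suc x) = ∣p∣≤1+∣p-x∣ p x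

x∉p-x : ∀ {n} (p : Subset n) x → x ∉ˢ p - x
x∉p-x (inside  ∷ p) zero ()
x∉p-x (outside ∷ p) zero ()
x∉p-x (_ ∷ p) (suc x) (there x∈) = x∉p-x p x x∈

∣⁅x⁆∪⁅y⁆∣≡2 : ∀ {n} {x y : Fin n} → x ≢ y → ∣ ⁅ x ⁆ ∪ ⁅ y ⁆ ∣ ≡ 2
∣⁅x⁆∪⁅y⁆∣≡2 {x = zero}  {zero}  x≢y = contradiction refl x≢y
∣⁅x⁆∪⁅y⁆∣≡2 {x = zero}  {suc y} x≢y = cong suc (trans (cong ∣_∣ (∪-identityˡ ⁅ y ⁆)) (∣⁅x⁆∣≡1 y))
∣⁅x⁆∪⁅y⁆∣≡2 {x = suc x} {zero}  x≢y = cong suc (trans (cong ∣_∣ (∪-identityʳ ⁅ x ⁆)) (∣⁅x⁆∣≡1 x))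
∣⁅x⁆∪⁅y⁆∣≡2 {x = suc x} {suc y} x≢y = ∣⁅x⁆∪⁅y⁆∣≡2 (x≢y ∘ cong suc)

-- Enumerating and counting subsets of prescribed size.

-- The sets S with R ⊆ S ⊆ R ∪ Y and ∣ S ∖ R ∣ = j.
between : ∀ {n} → Subset n → Subset n → ℕ → List (Subset n)
between []            []            zero    = [ [] ]
between []            []            (suc j) = []
between (inside  ∷ R) (_       ∷ Y) j       = map (inside ∷_) (between R Y j)
between (outside ∷ R) (outside ∷ Y) j       = map (outside ∷_) (between R Y j)
between (outside ∷ R) (inside  ∷ Y) zero    = map (outside ∷_) (between R Y zero)
between (outside ∷ R) (inside  ∷ Y) (suc j) =
  map (inside ∷_) (between R Y j) ++ map (outside ∷_) (between R Y (suc j))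

between-unique : ∀ {n} (R Y : Subset n) j → Unique (between R Y j)
between-unique []            []            zero    = All.[] ∷ []
between-unique []            []            (suc j) = []
between-unique (inside  ∷ R) (_       ∷ Y) j       = Unique.map⁺ ∷-injectiveʳ (between-unique R Y j)
between-unique (outside ∷ R) (outside ∷ Y) j       = Unique.map⁺ ∷-injectiveʳ (between-unique R Y j)
between-unique (outside ∷ R) (inside  ∷ Y) zero    = Unique.map⁺ ∷-injectiveʳ (between-unique R Y zero)
between-unique (outside ∷ R) (inside  ∷ Y) (suc j) =
  Unique.++⁺ (Unique.map⁺ ∷-injectiveʳ (between-unique R Y j))
             (Unique.map⁺ ∷-injectiveʳ (between-unique R Y (suc j))) disjoint
  where
  disjoint : ∀ {S} → S ∈ map (inside ∷_) (between R Y j) × S ∈ map (outside ∷_) (between R Y (suc j)) → ⊥₀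
  disjoint (p , q) with ∈-map⁻ (inside ∷_) p | ∈-map⁻ (outside ∷_) q
  ... | _ , _ , refl | _ , _ , ()

∈-between⁺ : ∀ {n} {S : Subset n} (R Y : Subset n) j → R ⊆ S → S ⊆ Y → ∣ S ∣ ≡ ∣ R ∣ + j → S ∈ between R Y j
∈-between⁺ {S = []} [] [] zero    R⊆S S⊆Y e = here refl
∈-between⁺ {S = outside ∷ S} (inside ∷ R) (_ ∷ Y) j R⊆S S⊆Y e with R⊆S here
... | ()
∈-between⁺ {S = inside ∷ S} (inside ∷ R) (_ ∷ Y) j R⊆S S⊆Y e =
  ∈-map⁺ _ (∈-between⁺ R Y j (drop-∷-⊆ R⊆S) (drop-∷-⊆ S⊆Y) (suc-injective e))
∈-between⁺ {S = inside ∷ S} (outside ∷ R) (outside ∷ Y) j R⊆S S⊆Y e with S⊆Y here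
... | ()
∈-between⁺ {S = outside ∷ S} (outside ∷ R) (outside ∷ Y) j R⊆S S⊆Y e =
  ∈-map⁺ _ (∈-between⁺ R Y j (drop-∷-⊆ R⊆S) (drop-∷-⊆ S⊆Y) e)
∈-between⁺ {S = inside ∷ S} (outside ∷ R) (inside ∷ Y) zero R⊆S S⊆Y e =
  contradiction (≤-reflexive (trans e (+-identityʳ _))) (<⇒≱ (s≤s (p⊆q⇒∣p∣≤∣q∣ (drop-∷-⊆ R⊆S))))
∈-between⁺ {S = outside ∷ S} (outside ∷ R) (inside ∷ Y) zero R⊆S S⊆Y e =
  ∈-map⁺ _ (∈-between⁺ R Y zero (drop-∷-⊆ R⊆S) (drop-∷-⊆ S⊆Y) e)
∈-between⁺ {S = inside ∷ S} (outside ∷ R) (inside ∷ Y) (suc j) R⊆S S⊆Y e =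
  ∈-++⁺ˡ (∈-map⁺ _ (∈-between⁺ R Y j (drop-∷-⊆ R⊆S) (drop-∷-⊆ S⊆Y)
    (suc-injective (trans e (+-suc _ j)))))
∈-between⁺ {S = outside ∷ S} (outside ∷ R) (inside ∷ Y) (suc j) R⊆S S⊆Y e =
  ∈-++⁺ʳ _ (∈-map⁺ _ (∈-between⁺ R Y (suc j) (drop-∷-⊆ R⊆S) (drop-∷-⊆ S⊆Y) e))

∈-between⁻ : ∀ {n} {S : Subset n} (R Y : Subset n) j → S ∈ between R Y j → S ⊆ R ∪ Y × ∣ S ∣ ≡ ∣ R ∣ + j
∈-between⁻ [] [] zero (here refl) = id , refl
∈-between⁻ (inside ∷ R) (_ ∷ Y) j S∈ with ∈-map⁻ _ S∈
... | _ , S∈′ , refl with ∈-between⁻ R Y j S∈′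
... | sub , e = s⊆s sub , cong suc e
∈-between⁻ (outside ∷ R) (outside ∷ Y) j S∈ with ∈-map⁻ _ S∈
... | _ , S∈′ , refl with ∈-between⁻ R Y j S∈′
... | sub , e = s⊆s sub , e
∈-between⁻ (outside ∷ R) (inside ∷ Y) zero S∈ with ∈-map⁻ _ S∈
... | _ , S∈′ , refl with ∈-between⁻ R Y zero S∈′
... | sub , e = out⊆ sub , e
∈-between⁻ (outside ∷ R) (inside ∷ Y) (suc j) S∈ with ∈-++⁻ (map (inside ∷_) (between R Y j)) S∈
... | inj₁ S∈ˡ with ∈-map⁻ _ S∈ˡ
...   | _ , S∈′ , refl with ∈-between⁻ R Y j S∈′
...     | sub , e = s⊆s sub , trans (cong suc e) (sym (+-suc _ j))
∈-between⁻ (outside ∷ R) (inside ∷ Y) (suc j) S∈ | inj₂ S∈ʳ with ∈-map⁻ _ S∈ʳ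
...   | _ , S∈′ , refl with ∈-between⁻ R Y (suc j) S∈′
...     | sub , e = out⊆ sub , e

-- Only the order of magnitude matters later. A point of `Y` outside `R` is taken or not, and y^j +
-- y^(j+1) = (1 + y) y^j ≤ (1 + y)^(j+1).
length-between≤ : ∀ {n} (R Y : Subset n) j → length (between R Y j) ≤ ∣ Y ∣ ^ j
length-between≤ []            []            zero    = ≤-refl
length-between≤ []            []            (suc j) = z≤n
length-between≤ (inside  ∷ R) (b       ∷ Y) j       = begin
  length (map (inside ∷_) (between R Y j))  ≡⟨ length-map _ (between R Y j) ⟩
  length (between R Y j)                    ≤⟨ length-between≤ R Y j ⟩
  ∣ Y ∣ ^ j                                 ≤⟨ ^-monoˡ-≤ j (∣p∣≤∣x∷p∣ b Y) ⟩
  ∣ b ∷ Y ∣ ^ j                             ∎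
  where open ≤-Reasoning
length-between≤ (outside ∷ R) (outside ∷ Y) j       =
  ≤-trans (≤-reflexive (length-map _ (between R Y j))) (length-between≤ R Y j)
length-between≤ (outside ∷ R) (inside  ∷ Y) zero    =
  ≤-trans (≤-reflexive (length-map _ (between R Y zero))) (length-between≤ R Y zero)
length-between≤ (outside ∷ R) (inside  ∷ Y) (suc j) = begin
  length (map (inside ∷_) (between R Y j) ++ map (outside ∷_) (between R Y (suc j)))
    ≡⟨ length-++ (map (inside ∷_) (between R Y j)) ⟩
  length (map (inside ∷_) (between R Y j)) + length (map (outside ∷_) (between R Y (suc j)))
    ≡⟨ cong₂ _+_ (length-map _ (between R Y j)) (length-map _ (between R Y (suc j))) ⟩
  length (between R Y j) + length (between R Y (suc j))
    ≤⟨ +-mono-≤ (length-between≤ R Y j) (length-between≤ R Y (suc j)) ⟩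
  suc ∣ Y ∣ * ∣ Y ∣ ^ j
    ≤⟨ *-monoʳ-≤ (suc ∣ Y ∣) (^-monoˡ-≤ j (n≤1+n ∣ Y ∣)) ⟩
  suc ∣ Y ∣ ^ suc j ∎
  where open ≤-Reasoning

ksubsets : ∀ {n} → Subset n → ℕ → List (Subset n)
ksubsets Y k = between ⊥ Y k

∈-ksubsets⁺ : ∀ {n} {S Y : Subset n} {k} → S ⊆ Y → ∣ S ∣ ≡ k → S ∈ ksubsets Y k
∈-ksubsets⁺ {n} {S} {Y} {k} S⊆Y e = ∈-between⁺ ⊥ Y k (λ x∈ → contradiction x∈ ∉⊥) S⊆Y (trans e (cong (_+ k) (sym (∣⊥∣≡0 n))))

∈-ksubsets⁻ : ∀ {n} {S Y : Subset n} {k} → S ∈ ksubsets Y k → S ⊆ Y × ∣ S ∣ ≡ k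
∈-ksubsets⁻ {n} {S} {Y} {k} S∈ with ∈-between⁻ ⊥ Y k S∈
... | sub , e = (λ x∈ → subst (_ ∈ˢ_) (∪-identityˡ Y) (sub x∈)) , trans e (cong (_+ k) (∣⊥∣≡0 n))

length-ksubsets : ∀ {n} (Y : Subset n) k → length (ksubsets Y k) ≡ ∣ Y ∣ C k
length-ksubsets []            zero    = refl
length-ksubsets []            (suc k) = refl
length-ksubsets (outside ∷ Y) k       = trans (length-map _ (ksubsets Y k)) (length-ksubsets Y k)
length-ksubsets (inside  ∷ Y) zero    = trans (length-map _ (ksubsets Y zero)) (length-ksubsets Y zero)
length-ksubsets (inside  ∷ Y) (suc k) = begin
  length (map (inside ∷_) (ksubsets Y k) ++ map (outside ∷_) (ksubsets Y (suc k)))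
    ≡⟨ length-++ (map (inside ∷_) (ksubsets Y k)) ⟩
  length (map (inside ∷_) (ksubsets Y k)) + length (map (outside ∷_) (ksubsets Y (suc k)))
    ≡⟨ cong₂ _+_ (length-map _ (ksubsets Y k)) (length-map _ (ksubsets Y (suc k))) ⟩
  length (ksubsets Y k) + length (ksubsets Y (suc k))
    ≡⟨ cong₂ _+_ (length-ksubsets Y k) (length-ksubsets Y (suc k)) ⟩
  ∣ Y ∣ C k + ∣ Y ∣ C suc k
    ≡⟨ nCk+nC[k+1]≡[n+1]C[k+1] ∣ Y ∣ k ⟩
  suc ∣ Y ∣ C suc k ∎
  where open ≡-Reasoning

-- Lower bounds for binomial coefficients.

-- Choose the least element among the first a points and the other k among the last b.
a*bCk≤[a+b]C[1+k] : ∀ a b k → a * (b C k) ≤ (a + b) C suc k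
a*bCk≤[a+b]C[1+k] zero    b k = z≤n
a*bCk≤[a+b]C[1+k] (suc a) b k = begin
  b C k + a * (b C k)           ≤⟨ +-mono-≤ (mono a) (a*bCk≤[a+b]C[1+k] a b k) ⟩
  (a + b) C k + (a + b) C suc k ≡⟨ nCk+nC[k+1]≡[n+1]C[k+1] (a + b) k ⟩
  suc (a + b) C suc k           ∎
  where
  open ≤-Reasoning
  step : ∀ m k → m C k ≤ suc m C k
  step m zero    = ≤-refl
  step m (suc k) = ≤-trans (m≤n+m _ (m C k)) (≤-reflexive (nCk+nC[k+1]≡[n+1]C[k+1] m k))
  mono : ∀ a → b C k ≤ (a + b) C k
  mono zero    = ≤-refl
  mono (suc a) = ≤-trans (mono a) (step (a + b) k)

-- Choose one point from each of k disjoint blocks of s points; every induction step splits off one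
-- block.
s^k≤nCk : ∀ {n} s k → k * s ≤ n → s ^ k ≤ n C k
s^k≤nCk {n} s zero    _  = ≤-refl
s^k≤nCk {n} s (suc k) ks≤n = begin
  s * s ^ k
    ≤⟨ *-monoʳ-≤ s (s^k≤nCk s k (m+n≤o⇒m≤o∸n (k * s) (≤-trans (≤-reflexive (+-comm (k * s) s)) ks≤n))) ⟩
  s * ((n ∸ s) C k)       ≤⟨ a*bCk≤[a+b]C[1+k] s (n ∸ s) k ⟩
  (s + (n ∸ s)) C suc k   ≡⟨ cong (_C suc k) (m+[n∸m]≡n (m+n≤o⇒m≤o s ks≤n)) ⟩
  n C suc k               ∎
  where open ≤-Reasoning

-- Structure of colour classes and deletion of large stars.

module RobustColouring {n} (j : ℕ) (c : Subset n → ℕ) (f : Subset n → Subset n)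
  (selected : ∀ {S T} → ∣ S ∣ ≡ 2 + j → ∣ T ∣ ≡ 2 + j → c S ≡ c T → Empty (S ∩ T) → f S ≡ T ⊎ f T ≡ S)
  where

  k : ℕ
  k = 2 + j

  class : Subset n → ℕ → List (Subset n)
  class Y i = filter (λ S → c S ≟ i) (ksubsets Y k)

  star : Subset n → ℕ → Fin n → List (Subset n)
  star Y i x = filter (x ∈?_) (class Y i)

  ∈-class⁻ : ∀ {Y i S} → S ∈ class Y i → S ⊆ Y × ∣ S ∣ ≡ k × c S ≡ i
  ∈-class⁻ {Y} {i} S∈ with ∈-filter⁻ (λ S → c S ≟ i) {xs = ksubsets Y k} S∈
  ... | S∈′ , cS with ∈-ksubsets⁻ {Y = Y} S∈′
  ... | S⊆Y , e = S⊆Y , e , cS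

  class-unique : ∀ Y i → Unique (class Y i)
  class-unique Y i = Unique.filter⁺ _ (between-unique ⊥ Y k)

  -- S selects at most one of A and B, so a third set disjoint from both is selected by one of them.
  selected-or-meets : ∀ {A B S i} → ∣ A ∣ ≡ k × c A ≡ i → ∣ B ∣ ≡ k × c B ≡ i → ∣ S ∣ ≡ k × c S ≡ i → A ≢ B →
    (S ≡ f A ⊎ S ≡ f B) ⊎ ∃ λ x → x ∈ˢ S × (x ∈ˢ A ⊎ x ∈ˢ B)
  selected-or-meets {A} {B} {S} (a , ca) (b , cb) (s , cs) A≢B with nonempty? (A ∩ S) | nonempty? (B ∩ S)
  ... | yes (x , x∈) | _ = inj₂ (x , proj₂ (x∈p∩q⁻ A S x∈) , inj₁ (proj₁ (x∈p∩q⁻ A S x∈)))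
  ... | no _ | yes (x , x∈) = inj₂ (x , proj₂ (x∈p∩q⁻ B S x∈) , inj₂ (proj₁ (x∈p∩q⁻ B S x∈)))
  ... | no A∩S | no B∩S with selected a s (trans ca (sym cs)) A∩S | selected b s (trans cb (sym cs)) B∩S
  ...   | inj₁ fA≡S | _         = inj₁ (inj₁ (sym fA≡S))
  ...   | inj₂ _    | inj₁ fB≡S = inj₁ (inj₂ (sym fB≡S))
  ...   | inj₂ fS≡A | inj₂ fS≡B = contradiction (trans (sym fS≡A) fS≡B) A≢B

  -- Each member of `L` is `f A`, `f B`, or passes through one of the 2k points of `A` and `B`. The
  -- lists `g x` are k-sets through a pair in `star-bound` and whole stars in `class-bound`.
  length≤-cover : ∀ {A B L i d} (g : Fin n → List (Subset n)) →
    ∣ A ∣ ≡ k × c A ≡ i → ∣ B ∣ ≡ k × c B ≡ i → A ≢ B →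
    Unique L → (∀ {S} → S ∈ L → ∣ S ∣ ≡ k × c S ≡ i) →
    (∀ {S x} → S ∈ L → x ∈ˢ S → x ∈ˢ A ⊎ x ∈ˢ B → S ∈ g x) → (∀ x → length (g x) ≤ d) →
    length L ≤ 2 + (k + k) * d
  length≤-cover {A} {B} {L} {i} {d} g a b A≢B unique good meets bound = begin
    length L                                              ≤⟨ unique-⊆⇒length≤ unique cover ⟩
    2 + length (concatMap g (elements A ++ elements B))
      ≤⟨ +-monoʳ-≤ 2 (length-concatMap≤ g d (elements A ++ elements B) (λ {x} _ → bound x)) ⟩
    2 + length (elements A ++ elements B) * d             ≡⟨ cong (λ l → 2 + l * d) length≡ ⟩
    2 + (k + k) * d                                       ∎
    where
    open ≤-Reasoning
    length≡ : length (elements A ++ elements B) ≡ k + k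
    length≡ = trans (length-++ (elements A))
      (cong₂ _+_ (trans (length-elements A) (proj₁ a)) (trans (length-elements B) (proj₁ b)))
    cover : ∀ {S} → S ∈ L → S ∈ f A ∷ f B ∷ concatMap g (elements A ++ elements B)
    cover S∈L with selected-or-meets a b (good S∈L) A≢B
    ... | inj₁ (inj₁ S≡fA) = here S≡fA
    ... | inj₁ (inj₂ S≡fB) = there (here S≡fB)
    ... | inj₂ (x , x∈S , x∈A⊎B) = there (there (∈-concatMap⁺ g (lose
            ([ ∈-++⁺ˡ ∘ ∈-elements⁺ A , ∈-++⁺ʳ (elements A) ∘ ∈-elements⁺ B ]′ x∈A⊎B) (meets S∈L x∈S x∈A⊎B))))

  threshold : ℕ → ℕ
  threshold y = 2 + (k + k) * y ^ j

  -- A member of the star other than `f A` and `f B` meets `A` or `B` in a point `a`, which differs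
  -- from `x` because `x` lies in neither. So it contains both `x` and `a`, and at most y^(k-2)
  -- k-subsets of `Y` do. Read backwards: if a star exceeds the threshold, at most one set of its
  -- class avoids the centre.
  star-bound : ∀ {Y i x A B} → A ∈ class Y i → B ∈ class Y i → x ∉ˢ A → x ∉ˢ B → A ≢ B →
               length (star Y i x) ≤ threshold ∣ Y ∣
  star-bound {Y} {i} {x} {A} {B} A∈ B∈ x∉A x∉B A≢B =
    length≤-cover (λ a → between (⁅ x ⁆ ∪ ⁅ a ⁆) Y j) (proj₂ (∈-class⁻ A∈)) (proj₂ (∈-class⁻ B∈)) A≢B
      (Unique.filter⁺ (x ∈?_) (class-unique Y i)) (proj₂ ∘ ∈-class⁻ ∘ proj₁ ∘ ∈-star⁻) meets
      (λ a → length-between≤ (⁅ x ⁆ ∪ ⁅ a ⁆) Y j)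
    where
    ∈-star⁻ : ∀ {S} → S ∈ star Y i x → S ∈ class Y i × x ∈ˢ S
    ∈-star⁻ = ∈-filter⁻ (x ∈?_) {xs = class Y i}
    meets : ∀ {S a} → S ∈ star Y i x → a ∈ˢ S → a ∈ˢ A ⊎ a ∈ˢ B → S ∈ between (⁅ x ⁆ ∪ ⁅ a ⁆) Y j
    meets {S} {a} S∈ a∈S a∈A⊎B with ∈-star⁻ S∈
    ... | S∈class , x∈S with ∈-class⁻ {Y} S∈class
    ... | S⊆Y , e , _ = ∈-between⁺ _ Y j sub S⊆Y (trans e (cong (_+ j) (sym (∣⁅x⁆∪⁅y⁆∣≡2 x≢a))))
      where
      x≢a : x ≢ a
      x≢a refl = [ x∉A , x∉B ]′ a∈A⊎B
      sub : ⁅ x ⁆ ∪ ⁅ a ⁆ ⊆ S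
      sub z∈ with x∈p∪q⁻ ⁅ x ⁆ ⁅ a ⁆ z∈
      ... | inj₁ z∈x = subst (_∈ˢ S) (sym (x∈⁅y⁆⇒x≡y x z∈x)) x∈S
      ... | inj₂ z∈a = subst (_∈ˢ S) (sym (x∈⁅y⁆⇒x≡y a z∈a)) a∈S

  -- Given two distinct members, all others except the two selected sets lie in the stars of their
  -- 2k points.
  class-bound : ∀ {Y i d} → (∀ x → length (star Y i x) ≤ d) → length (class Y i) ≤ 2 + (k + k) * d
  class-bound {Y} {i} small with unique⇒length≤1⊎distinct (class-unique Y i)
  ... | inj₁ length≤1 = ≤-trans length≤1 (s≤s z≤n)
  ... | inj₂ (A , B , A∈ , B∈ , A≢B) =
    length≤-cover (star Y i) (proj₂ (∈-class⁻ {Y} A∈)) (proj₂ (∈-class⁻ {Y} B∈)) A≢B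
      (class-unique Y i) (proj₂ ∘ ∈-class⁻ {Y}) (λ S∈ x∈S _ → ∈-filter⁺ (_ ∈?_) S∈ x∈S) small

  -- Invariant of the deletion: `Q` holds the colours still in play, `Ex` the k-sets given up with
  -- deleted colours.
  Covered : Subset n → List ℕ → List (Subset n) → Set
  Covered Y Q Ex = ∀ {S} → S ⊆ Y → ∣ S ∣ ≡ k → S ∈ Ex ⊎ c S ∈ Q

  -- A class with a star exceeding the threshold is removed together with the centre of that star;
  -- this loses at most one k-set of the ground set Y, which is recorded as exceptional.
  remove-stars : ∀ {m t} fuel Y Q Ex → length Q ≤ fuel → Covered Y Q Ex →
    t + length Q ≤ ∣ Y ∣ → length Ex + length Q ≤ m →
    ∃ λ y → t ≤ y × y C k ≤ m + y * (2 + (k + k) * threshold y)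
  remove-stars {m} {t} fuel Y Q Ex q≤fuel cov tq≤y eq≤m
    with any? (λ i → Fin.any? (λ x → threshold ∣ Y ∣ <? length (star Y i x))) Q
  -- All remaining classes are small, so the k-subsets of `Y` are covered by at most `m` exceptional
  -- sets and at most y small classes.
  ... | no none = ∣ Y ∣ , m+n≤o⇒m≤o t tq≤y , (begin
      ∣ Y ∣ C k                                 ≡⟨ length-ksubsets Y k ⟨
      length (ksubsets Y k)                     ≤⟨ unique-⊆⇒length≤ (between-unique ⊥ Y k) cover ⟩
      length (Ex ++ concatMap (class Y) Q)      ≡⟨ length-++ Ex ⟩
      length Ex + length (concatMap (class Y) Q) ≤⟨ +-monoʳ-≤ (length Ex) (length-concatMap≤ (class Y) b Q small) ⟩
      length Ex + length Q * b                  ≤⟨ +-mono-≤ (m+n≤o⇒m≤o (length Ex) eq≤m) (*-monoˡ-≤ b (m+n≤o⇒n≤o t tq≤y)) ⟩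
      m + ∣ Y ∣ * b                             ∎)
    where
    open ≤-Reasoning
    b : ℕ
    b = 2 + (k + k) * threshold ∣ Y ∣
    small : ∀ {i} → i ∈ Q → length (class Y i) ≤ b
    small i∈Q = class-bound (λ x → ≮⇒≥ (λ big → none (lose i∈Q (x , big))))
    cover : ∀ {S} → S ∈ ksubsets Y k → S ∈ Ex ++ concatMap (class Y) Q
    cover S∈ with ∈-ksubsets⁻ {Y = Y} S∈
    ... | S⊆Y , e with cov S⊆Y e
    ...   | inj₁ S∈Ex = ∈-++⁺ˡ S∈Ex
    ...   | inj₂ cS∈Q = ∈-++⁺ʳ Ex (∈-concatMap⁺ (class Y) (lose cS∈Q (∈-filter⁺ _ S∈ refl)))
  -- Fuel bounds the number of remaining colours, so here no colour is left to have a large star.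
  remove-stars zero Y [] Ex q≤fuel cov tq≤y eq≤m | yes ()
  remove-stars {m} {t} (suc fuel) Y Q Ex q≤fuel cov tq≤y eq≤m | yes found with find found
  ... | i , i∈Q , x , big =
    -- `Y` loses at most one point, `Q` at least one colour, and `Ex` gains at most one set, so both
    -- numerical invariants persist.
    remove-stars fuel (Y - x) Q′ (missed ++ Ex) (s≤s⁻¹ (≤-trans q′<q q≤fuel)) cov′
      (s≤s⁻¹ (begin
        suc (t + length Q′)                       ≡⟨ +-suc t (length Q′) ⟨
        t + suc (length Q′)                       ≤⟨ +-monoʳ-≤ t q′<q ⟩
        t + length Q                              ≤⟨ tq≤y ⟩
        ∣ Y ∣                                     ≤⟨ ∣p∣≤1+∣p-x∣ Y x ⟩
        suc ∣ Y - x ∣                             ∎))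
      (begin
        length (missed ++ Ex) + length Q′         ≡⟨ cong (_+ length Q′) (length-++ missed) ⟩
        length missed + length Ex + length Q′     ≤⟨ +-monoˡ-≤ (length Q′) (+-monoˡ-≤ (length Ex) missed≤1) ⟩
        suc (length Ex + length Q′)               ≡⟨ +-suc (length Ex) (length Q′) ⟨
        length Ex + suc (length Q′)               ≤⟨ +-monoʳ-≤ (length Ex) q′<q ⟩
        length Ex + length Q                      ≤⟨ eq≤m ⟩
        m                                         ∎)
    where
    open ≤-Reasoning
    Q′ : List ℕ
    Q′ = filter (λ i′ → ¬? (i′ ≟ i)) Q
    missed : List (Subset n)
    missed = filter (λ S → ¬? (x ∈? S)) (class Y i)
    q′<q : length Q′ < length Q
    q′<q = filter-notAll _ Q (Any.map (λ i≡ i≢ → i≢ (sym i≡)) i∈Q)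
    missed≤1 : length missed ≤ 1
    missed≤1 with unique⇒length≤1⊎distinct (Unique.filter⁺ (λ S → ¬? (x ∈? S)) (class-unique Y i))
    ... | inj₁ length≤1 = length≤1
    ... | inj₂ (A , B , A∈ , B∈ , A≢B)
      with ∈-filter⁻ (λ S → ¬? (x ∈? S)) {xs = class Y i} A∈ | ∈-filter⁻ (λ S → ¬? (x ∈? S)) {xs = class Y i} B∈
    ...   | A∈′ , x∉A | B∈′ , x∉B = contradiction (star-bound A∈′ B∈′ x∉A x∉B A≢B) (<⇒≱ big)
    cov′ : Covered (Y - x) Q′ (missed ++ Ex)
    cov′ {S} S⊆Y-x e with cov (λ z∈ → p─q⊆p Y ⁅ x ⁆ (S⊆Y-x z∈)) e
    ... | inj₁ S∈Ex = inj₁ (∈-++⁺ʳ missed S∈Ex)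
    ... | inj₂ cS∈Q with c S ≟ i
    ...   | no  cS≢i = inj₂ (∈-filter⁺ _ cS∈Q cS≢i)
    -- `S` has the deleted colour and avoids `x`, so it is the missed set.
    ...   | yes cS≡i = inj₁ (∈-++⁺ˡ (∈-filter⁺ _
              (∈-filter⁺ _ (∈-ksubsets⁺ (λ z∈ → p─q⊆p Y ⁅ x ⁆ (S⊆Y-x z∈)) e) cS≡i)
              (λ x∈S → x∉p-x Y x (S⊆Y-x x∈S))))

  -- Start the deletion with all n points, all `m` colours and no exceptional set; points minus
  -- colours is then `n ∸ m`.
  few-colours : ∀ {m} → m ≤ n → (∀ S → ∣ S ∣ ≡ k → c S < m) →
    ∃ λ y → n ∸ m ≤ y × y C k ≤ m + y * (2 + (k + k) * threshold y)
  few-colours {m} m≤n c<m = remove-stars m ⊤ (upTo m) [] (≤-reflexive (length-upTo m))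
    (λ {S} _ e → inj₂ (∈-upTo⁺ (c<m S e)))
    (≤-reflexive (trans (cong (n ∸ m +_) (length-upTo m)) (trans (m∸n+n≡m m≤n) (sym (∣⊤∣≡n n)))))
    (≤-reflexive (length-upTo m))

-- Solving the binomial inequality for y.

[m*n]^o≡m^o*n^o : ∀ m n o → (m * n) ^ o ≡ m ^ o * n ^ o
[m*n]^o≡m^o*n^o m n zero    = refl
[m*n]^o≡m^o*n^o m n (suc o) =
  trans (cong (m * n *_) ([m*n]^o≡m^o*n^o m n o)) (lemma m n (m ^ o) (n ^ o))
  where
  lemma : ∀ m n a b → m * n * (a * b) ≡ m * a * (n * b)
  lemma = solve-∀

module _ (j : ℕ) where
  private
    -- Once s = y / k is positive, the error term is at most M y^(k-1), and y ≤ K s turns this into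
    -- W s^(k-1).
    k K M W : ℕ
    k = 2 + j
    K = k + k
    M = 2 + K * (2 + K)
    W = M * K ^ suc j

  -- The binomial coefficient is at least s^k for s = y / k, while the error is O(s^(k-1)). For
  -- large s the error is at most half of s^k, whence s^k ≤ 2m; for bounded s the constant suffices.
  -- The factor c^k expresses y ≤ c n^(1/k) without roots.
  binomial-growth : ∃ λ c → 1 ≤ c × (∀ n m y → 1 ≤ n → m ≤ n →
    y C k ≤ m + y * (2 + K * (2 + K * y ^ j)) → y ^ k ≤ c ^ k * n)
  binomial-growth = c , s≤s z≤n , bound
    where
    open ≤-Reasoning
    c₀ c : ℕ
    -- `c₀` bounds y when y / k ≤ 2W; the summand 2K of `c` serves the other case.
    c₀ = k * suc (2 * W)
    c  = 2 * K + c₀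
    bound : ∀ n m y → 1 ≤ n → m ≤ n → y C k ≤ m + y * (2 + K * (2 + K * y ^ j)) → y ^ k ≤ c ^ k * n
    bound n m y 1≤n m≤n few with y / k ≤? 2 * W
    ... | yes s≤2W = begin
      y ^ k       ≤⟨ ^-monoˡ-≤ k y≤c ⟩
      c ^ k       ≡⟨ *-identityʳ (c ^ k) ⟨
      c ^ k * 1   ≤⟨ *-monoʳ-≤ (c ^ k) 1≤n ⟩
      c ^ k * n   ∎
      where
      y≤c : y ≤ c
      y≤c = begin
        y                   ≡⟨ m≡m%n+[m/n]*n y k ⟩
        y % k + y / k * k   ≤⟨ +-mono-≤ (<⇒≤ (m%n<n y k)) (*-monoˡ-≤ k s≤2W) ⟩
        suc (2 * W) * k     ≡⟨ *-comm (suc (2 * W)) k ⟩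
        c₀                  ≤⟨ m≤n+m c₀ (2 * K) ⟩
        c                   ∎
    ... | no s≰2W = begin
      y ^ k                 ≤⟨ ^-monoˡ-≤ k y≤Ks ⟩
      (K * s) ^ k           ≡⟨ [m*n]^o≡m^o*n^o K s k ⟩
      K ^ k * s ^ k         ≤⟨ *-monoʳ-≤ (K ^ k) sᵏ≤2m ⟩
      -- Weakening 2 to 2^k makes the constant a k-th power.
      K ^ k * (2 * m)       ≤⟨ *-monoʳ-≤ (K ^ k) (*-mono-≤ (^-monoʳ-≤ 2 {1} {k} (s≤s z≤n)) m≤n) ⟩
      K ^ k * (2 ^ k * n)   ≡⟨ lemma (K ^ k) (2 ^ k) n ⟩
      2 ^ k * K ^ k * n     ≡⟨ cong (_* n) ([m*n]^o≡m^o*n^o 2 K k) ⟨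
      (2 * K) ^ k * n       ≤⟨ *-monoˡ-≤ n (^-monoˡ-≤ k (m≤m+n (2 * K) c₀)) ⟩
      c ^ k * n             ∎
      where
      s : ℕ
      s = y / k
      2W<s : 2 * W < s
      2W<s = ≰⇒> s≰2W
      lemma : ∀ a b n → a * (b * n) ≡ b * a * n
      lemma = solve-∀
      y≤Ks : y ≤ K * s
      y≤Ks = begin
        y               ≡⟨ m≡m%n+[m/n]*n y k ⟩
        y % k + s * k   ≤⟨ +-monoˡ-≤ (s * k) (<⇒≤ (m%n<n y k)) ⟩
        k + s * k       ≤⟨ +-monoˡ-≤ (s * k) (m≤n*m k s {{>-nonZero (≤-trans (s≤s z≤n) 2W<s)}}) ⟩
        s * k + s * k   ≡⟨ lemma′ s k ⟩
        K * s           ∎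
        where
        lemma′ : ∀ s k → s * k + s * k ≡ (k + k) * s
        lemma′ = solve-∀
      ks≤y : k * s ≤ y
      ks≤y = ≤-trans (≤-reflexive (*-comm k s)) (m/n*n≤m y k)
      1≤y : 1 ≤ y
      1≤y = ≤-trans (≤-trans (≤-trans (s≤s z≤n) 2W<s) (m≤m+n s _)) ks≤y
      1≤yʲ : 1 ≤ y ^ j
      1≤yʲ = m^n>0 y {{>-nonZero 1≤y}} j
      error≤ : y * (2 + K * (2 + K * y ^ j)) ≤ W * s ^ suc j
      error≤ = begin
        y * (2 + K * (2 + K * y ^ j))
          -- As y^j ≥ 1, each constant 2 may become 2 y^j, which gives every term degree k - 1.
          ≤⟨ *-monoʳ-≤ y (+-mono-≤ (*-monoʳ-≤ 2 1≤yʲ) (*-monoʳ-≤ K (+-monoˡ-≤ (K * y ^ j) (*-monoʳ-≤ 2 1≤yʲ)))) ⟩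
        y * (2 * y ^ j + K * (2 * y ^ j + K * y ^ j))
          ≡⟨ factor y (y ^ j) K ⟩
        M * y ^ suc j               ≤⟨ *-monoʳ-≤ M (^-monoˡ-≤ (suc j) y≤Ks) ⟩
        M * (K * s) ^ suc j         ≡⟨ cong (M *_) ([m*n]^o≡m^o*n^o K s (suc j)) ⟩
        M * (K ^ suc j * s ^ suc j) ≡⟨ *-assoc M (K ^ suc j) (s ^ suc j) ⟨
        W * s ^ suc j               ∎
        where
        factor : ∀ y a K → y * (2 * a + K * (2 * a + K * a)) ≡ (2 + K * (2 + K)) * (y * a)
        factor = solve-∀
      sᵏ≤2m : s ^ k ≤ 2 * m
      -- The doubled error 2W s^(k-1) is at most s^k since 2W < s; one s^k then cancels.
      sᵏ≤2m = +-cancelʳ-≤ (s ^ k) (s ^ k) (2 * m) (begin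
        s ^ k + s ^ k                     ≡⟨ double (s ^ k) ⟩
        2 * s ^ k                         ≤⟨ *-monoʳ-≤ 2 (≤-trans (s^k≤nCk s k ks≤y) few) ⟩
        2 * (m + y * (2 + K * (2 + K * y ^ j))) ≤⟨ *-monoʳ-≤ 2 (+-monoʳ-≤ m error≤) ⟩
        2 * (m + W * s ^ suc j)           ≡⟨ distrib m W (s ^ suc j) ⟩
        2 * m + 2 * W * s ^ suc j         ≤⟨ +-monoʳ-≤ (2 * m) (*-monoˡ-≤ (s ^ suc j) (<⇒≤ 2W<s)) ⟩
        2 * m + s ^ k                     ∎)
        where
        double : ∀ a → a + a ≡ 2 * a
        double = solve-∀
        distrib : ∀ m W a → 2 * (m + W * a) ≡ 2 * m + 2 * W * a
        distrib = solve-∀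

-- From a robust colouring to total functions on subsets.

-- Sets of the wrong size get junk values: colour 0, and themselves as selected set.
module Extension {n j m} (colourable : Robust1Colourable (KG n (2 + j)) m) where
  private
    k : ℕ
    k = 2 + j
    Vertex : Set
    Vertex = V (KG n k)
    choose : Vertex → Maybe Vertex
    choose = proj₁ (proj₁ colourable)
    colour : Vertex → Fin m
    colour = proj₁ (proj₂ colourable)
    proper : ProperColouringOfRemoved (KG n k) (proj₁ colourable) m colour
    proper = proj₂ (proj₂ colourable)

    c′ : ∀ S → Dec (∣ S ∣ ≡ k) → ℕ
    c′ S (yes e) = toℕ (colour (S , e))
    c′ S (no _)  = 0
    f′ : ∀ S → Dec (∣ S ∣ ≡ k) → Subset n
    -- A vertex selecting nothing defaults to itself. `selected` only uses that selecting T makes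
    -- the value T.
    f′ S (yes e) = maybe′ proj₁ S (choose (S , e))
    f′ S (no _)  = S

  c : Subset n → ℕ
  c S = c′ S (∣ S ∣ ≟ k)

  f : Subset n → Subset n
  f S = f′ S (∣ S ∣ ≟ k)

  c<m : ∀ S → ∣ S ∣ ≡ k → c S < m
  c<m S e with ∣ S ∣ ≟ k
  ... | yes e′ = Fin.toℕ<n (colour (S , e′))
  ... | no ¬e  = contradiction e ¬e

  selected : ∀ {S T} → ∣ S ∣ ≡ k → ∣ T ∣ ≡ k → c S ≡ c T → Empty (S ∩ T) → f S ≡ T ⊎ f T ≡ S
  selected {S} {T} s t cS≡cT disjoint with ∣ S ∣ ≟ k | ∣ T ∣ ≟ k
  ... | no ¬s | _     = contradiction s ¬s
  ... | yes _ | no ¬t = contradiction t ¬t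
  ... | yes s′ | yes t′ with ≡-dec Bool._≟_ (f′ S (yes s′)) T | ≡-dec Bool._≟_ (f′ T (yes t′)) S
  ...   | yes fS≡T | _        = inj₁ fS≡T
  ...   | no _     | yes fT≡S = inj₂ fT≡S
  -- Neither end selects the edge, so it survives and properness forbids equal colours.
  ...   | no fS≢T  | no fT≢S  = contradiction (Fin.toℕ-injective cS≡cT)
    (proper (S , s′) (T , t′) disjoint (fS≢T ∘ cong (maybe′ proj₁ S)) (fT≢S ∘ cong (maybe′ proj₁ T)))

-- A robust colouring with few colours.

-- The first `m` points double as the colours; the last `t` form T, and each k-subset of T joins the
-- class of one of the first `m` points.
module Construction (m t j : ℕ) (tᵏ≤m : t ^ suc j ≤ m) where
  k : ℕ
  k = suc j

  tail : ∀ m → Subset (m + t)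
  tail zero    = ⊤
  tail (suc m) = outside ∷ tail m

  ∣tail∣≡t : ∀ m → ∣ tail m ∣ ≡ t
  ∣tail∣≡t zero    = ∣⊤∣≡n t
  ∣tail∣≡t (suc m) = ∣tail∣≡t m

  ⊆tail : ∀ m {S : Subset (m + t)} → (∀ x → x ↑ˡ t ∉ˢ S) → S ⊆ tail m
  ⊆tail zero    none z∈         = ∈⊤
  ⊆tail (suc m) none here       = contradiction here (none zero)
  ⊆tail (suc m) none (there z∈) = there (⊆tail m (λ x x∈ → none (suc x) (there x∈)) z∈)

  G : Graph
  G = KG (m + t) k

  absorbed : List (Subset (m + t))
  absorbed = ksubsets (tail m) k

  length-absorbed≤m : length absorbed ≤ m
  length-absorbed≤m = ≤-trans (length-between≤ ⊥ (tail m) k)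
    (≤-trans (≤-reflexive (cong (_^ k) (∣tail∣≡t m))) tᵏ≤m)

  absorber : Fin (length absorbed) → Fin m
  absorber i = inject≤ i length-absorbed≤m

  Head : V G → Set
  Head v = ∃ λ (x : Fin m) → x ↑ˡ t ∈ˢ proj₁ v

  head? : ∀ v → Dec (Head v)
  head? v = Fin.any? λ x → x ↑ˡ t ∈? proj₁ v

  rank : ∀ v → ¬ Head v → Fin (length absorbed)
  rank (S , e) none = index (∈-ksubsets⁺ {Y = tail m} (⊆tail m (λ x x∈ → none (x , x∈))) e)

  lookup-rank : ∀ v none → proj₁ v ≡ lookup absorbed (rank v none)
  lookup-rank v none = lookup-index (∈-ksubsets⁺ {Y = tail m} (⊆tail m (λ x x∈ → none (x , x∈))) (proj₂ v))

  colour′ : ∀ v → Dec (Head v) → Fin m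
  colour′ v (yes (x , _)) = x
  colour′ v (no none)     = absorber (rank v none)

  -- The k-subset of T that borrowed colour `x`. Disjointness is required for the selected edge to
  -- exist.
  Target : V G → Fin m → Set
  Target v x = ∃ λ i → absorber i ≡ x × Empty (proj₁ v ∩ lookup absorbed i)

  target? : ∀ v x → Dec (Target v x)
  target? v x = Fin.any? λ i → (absorber i Fin.≟ x) ×-dec ¬? (nonempty? (proj₁ v ∩ lookup absorbed i))

  select-target : ∀ v x → Dec (Target v x) → Maybe (V G)
  select-target v x (yes (i , _)) = just (lookup absorbed i , proj₂ (∈-ksubsets⁻ {Y = tail m} (∈-lookup i)))
  select-target v x (no _)        = nothing

  select : ∀ v → Dec (Head v) → Maybe (V G)
  select v (yes (x , _)) = select-target v x (target? v x)
  select v (no _)        = nothing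

  select-adjacent : ∀ v w (h : Dec (Head v)) → select v h ≡ just w → Adj G v w
  select-adjacent v w (yes (x , _)) eq with target? v x
  select-adjacent v w (yes (x , _)) refl | yes (_ , _ , disjoint) = disjoint

  V-≡ : ∀ (u v : V G) → proj₁ u ≡ proj₁ v → u ≡ v
  V-≡ (S , e) (.S , e′) refl = cong (S ,_) (≡-irrelevant e e′)

  -- The rank of `u` witnesses a target of `w`, and injectivity of `absorber` makes it the only one.
  star-selects : ∀ u w none (x∈ : Head w) → absorber (rank u none) ≡ proj₁ x∈ → Empty (proj₁ w ∩ proj₁ u) →
                 select w (yes x∈) ≡ just u
  star-selects u w none (x , _) eq disjoint with target? w x
  ... | yes (i , eq′ , _) = cong just (V-≡ _ u (trans
          (cong (lookup absorbed) (Fin.inject≤-injective _ _ i (rank u none) (trans eq′ (sym eq))))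
          (sym (lookup-rank u none))))
  ... | no ¬target = contradiction
          (rank u none , eq , subst (λ S → Empty (proj₁ w ∩ S)) (lookup-rank u none) disjoint) ¬target

  Empty-sym : ∀ {n} (p q : Subset n) → Empty (p ∩ q) → Empty (q ∩ p)
  Empty-sym p q = subst Empty (∩-comm p q)

  proper : ∀ u w (du : Dec (Head u)) (dw : Dec (Head w)) → Adj G u w →
           ¬ (select u du ≡ just w) → ¬ (select w dw ≡ just u) → colour′ u du ≢ colour′ w dw
  -- A shared head colour is a shared point, so the sets are not adjacent.
  proper u w (yes (x , x∈u)) (yes (.x , x∈w)) adj _ _ refl = adj (x ↑ˡ t , x∈p∩q⁺ (x∈u , x∈w))
  proper u w (yes x∈u) (no none) adj ¬uw ¬wu eq = ¬uw (star-selects w u none x∈u (sym eq) adj)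
  proper u w (no none) (yes x∈w) adj ¬uw ¬wu eq =
    ¬wu (star-selects u w none x∈w eq (Empty-sym (proj₁ u) (proj₁ w) adj))
  -- Equal colours force equal sets, and a set disjoint from itself is empty, against k ≥ 1.
  proper u w (no nu) (no nw) adj _ _ eq = contradiction (begin
    k                   ≡⟨ proj₂ u ⟨
    ∣ proj₁ u ∣         ≡⟨ cong ∣_∣ (trans (sym (∩-idem (proj₁ u))) (cong (proj₁ u ∩_) u≡w)) ⟩
    ∣ proj₁ u ∩ proj₁ w ∣ ≡⟨ cong ∣_∣ (Empty-unique adj) ⟩
    ∣ ⊥ {m + t} ∣       ≡⟨ ∣⊥∣≡0 (m + t) ⟩
    0                   ∎) λ ()
    where
    open ≡-Reasoning
    u≡w : proj₁ u ≡ proj₁ w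
    u≡w = trans (lookup-rank u nu) (trans
      (cong (lookup absorbed) (Fin.inject≤-injective _ _ (rank u nu) (rank w nw) eq)) (sym (lookup-rank w nw)))

  colourable : Robust1Colourable G m
  colourable = ((λ v → select v (head? v)) , λ v w → select-adjacent v w (head? v)) ,
    (λ v → colour′ v (head? v)) , λ u w → proper u w (head? u) (head? w)

-- Choosing the size of T.

-- The largest T the construction allows on n points. When n grows by one, t grows by at most one.
greatest-root : ∀ j n → ∃ λ t → t ^ suc j + t ≤ n × n < suc t ^ suc j + suc t
greatest-root j zero = 0 , z≤n , ≤-trans (m^n>0 1 (suc j)) (m≤m+n (1 ^ suc j) 1)
greatest-root j (suc n) with greatest-root j n
... | t , lo , hi with suc t ^ suc j + suc t ≤? suc n
...   | yes lo′ = suc t , lo′ , (begin-strict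
        suc n                          ≤⟨ hi ⟩
        suc t ^ suc j + suc t          <⟨ +-mono-≤-< (^-monoˡ-≤ (suc j) (n≤1+n (suc t))) (n<1+n (suc t)) ⟩
        suc (suc t) ^ suc j + suc (suc t) ∎)
        where open ≤-Reasoning
...   | no ¬lo′ = t , m≤n⇒m≤1+n lo , ≰⇒> ¬lo′

-- For t ≥ 1 both summands are at most (2t)^k, and 2 ≤ 2^k.
n≤[4t]^k : ∀ {n t} j → 2 ≤ n → n < suc t ^ suc (suc j) + suc t → n ≤ (4 * t) ^ suc (suc j)
-- For t = 0 the bound `hi` says n < 2, which explains the choice N = 2.
n≤[4t]^k {n} {zero} j 2≤n hi = contradiction 2≤n (<⇒≱ (subst (n <_) (cong (_+ 1) (^-zeroˡ (2 + j))) hi))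
n≤[4t]^k {n} {t@(suc _)} j 2≤n hi = begin
  n                             ≤⟨ <⇒≤ hi ⟩
  suc t ^ k + suc t             ≤⟨ +-mono-≤ (^-monoˡ-≤ k 1+t≤2t) 1+t≤2t ⟩
  (2 * t) ^ k + 2 * t
    ≤⟨ +-monoʳ-≤ ((2 * t) ^ k) (≤-trans (≤-reflexive (sym (^-identityʳ (2 * t)))) (^-monoʳ-≤ (2 * t) {1} {k} (s≤s z≤n))) ⟩
  (2 * t) ^ k + (2 * t) ^ k     ≡⟨ cong ((2 * t) ^ k +_) (+-identityʳ _) ⟨
  2 * (2 * t) ^ k               ≤⟨ *-monoˡ-≤ ((2 * t) ^ k) (^-monoʳ-≤ 2 {1} {k} (s≤s z≤n)) ⟩
  2 ^ k * (2 * t) ^ k           ≡⟨ [m*n]^o≡m^o*n^o 2 (2 * t) k ⟨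
  (2 * (2 * t)) ^ k             ≡⟨ cong (_^ k) (*-assoc 2 2 t) ⟨
  (4 * t) ^ k                   ∎
  where
  open ≤-Reasoning
  k : ℕ
  k = 2 + j
  1+t≤2t : suc t ≤ 2 * t
  1+t≤2t = ≤-trans (+-monoˡ-≤ t (s≤s z≤n)) (≤-reflexive (cong (t +_) (sym (+-identityʳ t))))

-- Combining the two bounds.

theorem1p7 : (k : ℕ) → 2 ≤ k →
    ∃ λ (d : ℕ) → ∃ λ (c : ℕ) → ∃ λ (N : ℕ) →
    1 ≤ d × 1 ≤ c ×
    (∀ (n : ℕ) → n ≥ N → 2 * k ≤ n → ∀ (χ : ℕ) → IsRobustChromaticNumber (KG n k) χ →
    (n ≤ (d * (n ∸ χ)) ^ k) × ((n ∸ χ) ^ k ≤ (c ^ k) * n))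
theorem1p7 (suc (suc j)) (s≤s (s≤s _)) with binomial-growth j
... | c , 1≤c , growth = 4 , c , 2 , s≤s z≤n , 1≤c , λ n 2≤n _ χ isχ → lower n 2≤n χ isχ , upper n 2≤n χ isχ
  where
  open ≤-Reasoning
  k : ℕ
  k = 2 + j

  lower : ∀ n → 2 ≤ n → ∀ χ → IsRobustChromaticNumber (KG n k) χ → n ≤ (4 * (n ∸ χ)) ^ k
  lower n 2≤n χ (_ , minimal) with greatest-root (suc j) n
  ... | t , lo , hi = begin
    n                   ≤⟨ n≤[4t]^k j 2≤n hi ⟩
    (4 * t) ^ k         ≤⟨ ^-monoˡ-≤ k (*-monoʳ-≤ 4 t≤n∸χ) ⟩
    (4 * (n ∸ χ)) ^ k   ∎
    where
    t≤n : t ≤ n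
    t≤n = m+n≤o⇒n≤o (t ^ k) lo
    colourable : Robust1Colourable (KG n k) (n ∸ t)
    -- The construction on (n - t) + t points uses n - t colours, so minimality gives χ ≤ n - t.
    colourable = subst (λ n′ → Robust1Colourable (KG n′ k) (n ∸ t)) (m∸n+n≡m t≤n)
      (Construction.colourable (n ∸ t) t (suc j) (m+n≤o⇒m≤o∸n (t ^ k) lo))
    t≤n∸χ : t ≤ n ∸ χ
    t≤n∸χ = begin
      t             ≡⟨ m∸[m∸n]≡n t≤n ⟨
      n ∸ (n ∸ t)   ≤⟨ ∸-monoʳ-≤ n (≮⇒≥ (λ n∸t<χ → minimal (n ∸ t) n∸t<χ colourable)) ⟩
      n ∸ χ         ∎

  upper : ∀ n → 2 ≤ n → ∀ χ → IsRobustChromaticNumber (KG n k) χ → (n ∸ χ) ^ k ≤ c ^ k * n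
  upper n 2≤n χ (colourable , _) with χ ≤? n
  -- Truncated subtraction gives 0 here, and 0^k = 0.
  ... | no χ≰n = ≤-trans (≤-reflexive (cong (_^ k) (m≤n⇒m∸n≡0 (<⇒≤ (≰⇒> χ≰n))))) z≤n
  ... | yes χ≤n with RobustColouring.few-colours j E.c E.f E.selected χ≤n E.c<m
    where module E = Extension colourable
  ...   | y , t≤y , few = ≤-trans (^-monoˡ-≤ k t≤y) (growth n χ y (<⇒≤ 2≤n) χ≤n few)
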